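{- Let $A=\begin{pmatrix}2&-b\\-c&2\end{pmatrix}$ with $b,c$ positive integers (i.e. $A$ is any $2\times2$ indecomposable symmetrisable generalised Cartan matrix). There are finitely many arithmetic $\mathbf{Y}$-frieze patterns associated to $A$ if and only if $A$ is of finite type (i.e. $bc\le3$). Moreover, the number of arithmetic $\mathbf{Y}$-frieze patterns associated to $A$ is $5$ if $A$ is of type $A_2$ ($bc=1$), $10$ if $A$ is of type $C_2$ ($bc=2$), and $21$ if $A$ is of type $G_2$ ($bc=3$).
   Context: An arithmetic $\mathbf{Y}$-frieze pattern associated to $A=(a_{i,j})$ is a map $k:[1,2]\times\mathbb{Z}\to\mathbb{Z}_{>0}$ with $k(i,m)k(i,m+1)=\prod_{j>i}(1+k(j,m))^{ -a_{j,i}}\prod_{j<i}(1+k(j,m+1))^{ -a_{j,i}}$ for all $(i,m)$; for this $A$ this reads $k(1,m)k(1,m+1)=(1+k(2,m))^{c}$ and $k(2,m)k(2,m+1)=(1+k(1,m+1))^{b}$. -}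

module Defs where

open import Data.Nat using (ℕ; suc; _+_; _*_; _^_; _<_; _≤_)
open import Data.Integer using (ℤ) renaming (_+_ to _+ℤ_; +_ to ⁺_)
open import Data.Fin using (Fin; zero; suc)
open import Data.List using (List)
open import Data.List.Relation.Unary.Any using (Any)
open import Data.Product using (Σ; _×_; ∃; proj₁)
open import Relation.Binary.PropositionalEquality using (_≡_)

one two : Fin 2
one = zero
two = suc zero

-- Arithmetic Y-frieze pattern for A = [[2,-b],[-c,2]]:
-- k : [1,2] × ℤ → ℤ_{>0}  (values in ℕ with positivity), satisfying
--   k(1,m) k(1,m+1) = (1 + k(2,m))^c
--   k(2,m) k(2,m+1) = (1 + k(1,m+1))^b
record IsYFrieze (b c : ℕ) (k : Fin 2 → ℤ → ℕ) : Set where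
  field
    positive : ∀ i m → 0 < k i m
    rel₁ : ∀ m → k one m * k one (m +ℤ ⁺ 1) ≡ (1 + k two m) ^ c
    rel₂ : ∀ m → k two m * k two (m +ℤ ⁺ 1) ≡ (1 + k one (m +ℤ ⁺ 1)) ^ b

YFrieze : ℕ → ℕ → Set
YFrieze b c = Σ (Fin 2 → ℤ → ℕ) (IsYFrieze b c)

_≈F_ : ∀ {b c} → YFrieze b c → YFrieze b c → Set
F ≈F G = ∀ i m → proj₁ F i m ≡ proj₁ G i m

FinitelyManyYFriezes : ℕ → ℕ → Set
FinitelyManyYFriezes b c =
  Σ (List (YFrieze b c)) λ L → ∀ (F : YFrieze b c) → Any (F ≈F_) L

ExactlyYFriezes : ℕ → ℕ → ℕ → Set
ExactlyYFriezes n b c =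
  Σ (Fin n → YFrieze b c) λ v →
    (∀ i j → v i ≈F v j → i ≡ j) × (∀ (F : YFrieze b c) → ∃ λ i → F ≈F v i)

{-# OPTIONS --safe #-}
module Submission where

-- A Y-frieze is determined by (x , y) = (k(1,0) , k(2,0)), and the pairs that occur
-- are exactly those with x ∣ (1 + y)ᶜ and y ∣ (1 + x)ᵇ, because the mutation
-- x ↦ (1 + y)ᶜ / x (and its mirror image) preserves these two divisibilities.
--
-- For bc ≥ 4, three consecutive terms of k(1,·) satisfy x x″ > x′², so the frieze through
-- (1 , 1) is unbounded and its translates are infinitely many friezes.
--
-- For bc ≤ 3 we may assume b = 1 and write 1 + x = k y, 1 + x′ = k′ y with x x′ = (1 + y)ᶜ.
-- Cancelling y leaves, with l = (c + k + k′) / y when c ≥ 2,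
--   c = 1 :  (k - 1)(k′ - 1) + k k′ (y - 1) = 2
--   c = 2 :  (k - 1)(k′ - 1) + l (y - 1) = 4
--   c = 3 :  (k - 1)(k′ - 1) + (l - 1)(y - 1) = 8
-- which bounds k and y, and the remaining pairs are checked by computation.

open import Defs
open import Data.Nat using (ℕ; zero; suc; _+_; _*_; _^_; _∸_; _≤_; _<_; z≤n; s≤s; >-nonZero)
open import Data.Nat.Properties
open import Data.Nat.Divisibility
open import Data.Nat.GeneralisedArithmetic using (fold)
open import Data.Nat.ListAction using (sum)
open import Data.Nat.Primality using (Prime; prime?; prime[2]; prime⇒irreducible; prime⇒nonZero)
open import Data.Nat.Tactic.RingSolver using (solve-∀)
open import Data.Integer using (ℤ; -[1+_]) renaming (_+_ to _+ℤ_; +_ to ⁺_)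
open import Data.Fin using (Fin; zero; suc)
import Data.Fin.Properties as Fin
open import Data.List using (map; tabulate)
open import Data.List.Relation.Unary.Any using (Any; here; there)
open import Data.List.Relation.Unary.Any.Properties using (tabulate⁺)
open import Data.Product using (Σ; ∃; _×_; _,_; proj₁; proj₂; swap)
open import Data.Product.Properties using () renaming (≡-dec to ×-≡-dec)
open import Data.Sum using (_⊎_; inj₁; inj₂)
open import Data.Vec using (Vec; []; _∷_; lookup)
open import Function using (_∘_)
open import Function.Bundles using (_⇔_; mk⇔)
open import Relation.Nullary using (¬_; Dec; contradiction)
open import Relation.Nullary.Decidable using (from-yes; toWitness; True; map′; _×-dec_; _→-dec_)
open import Relation.Binary.PropositionalEquality
  using (_≡_; refl; sym; trans; cong; cong₂; subst; module ≡-Reasoning)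

private
  variable
    b c : ℕ

-- Divisibility and mutation of seeds.

^-distribʳ-* : ∀ n x y → (x * y) ^ n ≡ x ^ n * y ^ n
^-distribʳ-* zero    x y = refl
^-distribʳ-* (suc n) x y =
  trans (cong (x * y *_) (^-distribʳ-* n x y)) ([m*n]*[o*p]≡[m*o]*[n*p] x y (x ^ n) (y ^ n))

^-+-* : ∀ d t u n → ∃ λ s → (u + d * t) ^ n ≡ u ^ n + d * s
^-+-* d t u zero    = 0 , cong suc (sym (*-zeroʳ d))
^-+-* d t u (suc n) with ^-+-* d t u n
... | s , eq = u * s + t * (u ^ n + d * s) ,
  trans (cong ((u + d * t) *_) eq) (lemma u d t (u ^ n) s)
  where
  lemma : ∀ u d t p s → (u + d * t) * (p + d * s) ≡ u * p + d * (u * s + t * (p + d * s))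
  lemma = solve-∀

-- As x x' ≡ 1 (mod y), we have x' (1 + x) ≡ 1 + x' (mod y).
exchange-∣ : ∀ {x x′ y} → x * x′ ≡ (1 + y) ^ c → y ∣ (1 + x) ^ b → y ∣ (1 + x′) ^ b
exchange-∣ {c} {b} {x} {x′} {y} xx′ y∣ with ^-+-* y 1 1 c
... | t , eq with ^-+-* y t (1 + x′) b
... | s , eq′ = ∣m+n∣m⇒∣n
  (subst (y ∣_) power (∣n⇒∣m*n (x′ ^ b) y∣)) (m∣m*n s)
  where
  open ≡-Reasoning
  product : x * x′ ≡ 1 + y * t
  product = begin
    x * x′            ≡⟨ xx′ ⟩
    (1 + y) ^ c       ≡⟨ cong (λ z → (1 + z) ^ c) (sym (*-identityʳ y)) ⟩
    (1 + y * 1) ^ c   ≡⟨ eq ⟩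
    1 ^ c + y * t     ≡⟨ cong (_+ y * t) (^-zeroˡ c) ⟩
    1 + y * t         ∎
  base : x′ * (1 + x) ≡ 1 + x′ + y * t
  base = begin
    x′ * (1 + x)      ≡⟨ lemma x x′ ⟩
    x * x′ + x′       ≡⟨ cong (_+ x′) product ⟩
    1 + y * t + x′    ≡⟨ cong suc (+-comm (y * t) x′) ⟩
    1 + x′ + y * t    ∎
    where
    lemma : ∀ x x′ → x′ * (1 + x) ≡ x * x′ + x′
    lemma = solve-∀
  power : x′ ^ b * (1 + x) ^ b ≡ y * s + (1 + x′) ^ b
  power = begin
    x′ ^ b * (1 + x) ^ b      ≡⟨ sym (^-distribʳ-* b x′ (1 + x)) ⟩
    (x′ * (1 + x)) ^ b        ≡⟨ cong (_^ b) base ⟩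
    (1 + x′ + y * t) ^ b      ≡⟨ eq′ ⟩
    (1 + x′) ^ b + y * s      ≡⟨ +-comm _ (y * s) ⟩
    y * s + (1 + x′) ^ b      ∎

factorʳ>0 : ∀ m {n o} → m * n ≡ (1 + o) ^ c → 0 < n
factorʳ>0 m {suc n} eq = s≤s z≤n
factorʳ>0 {c} m {zero} {o} eq =
  contradiction (subst (0 <_) (trans (sym eq) (*-zeroʳ m)) (m^n>0 (1 + o) c)) λ ()

record IsSeed (b c : ℕ) (s : ℕ × ℕ) : Set where
  constructor mkSeed
  field
    x>0 : 0 < proj₁ s
    y>0 : 0 < proj₂ s
    x∣  : proj₁ s ∣ (1 + proj₂ s) ^ c
    y∣  : proj₂ s ∣ (1 + proj₁ s) ^ b

Seed : ℕ → ℕ → Set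
Seed b c = ∃ (IsSeed b c)

swap-isSeed : ∀ {s} → IsSeed b c s → IsSeed c b (swap s)
swap-isSeed (mkSeed x>0 y>0 x∣ y∣) = mkSeed y>0 x>0 y∣ x∣

swapSeed : Seed b c → Seed c b
swapSeed (s , isSeed) = swap s , swap-isSeed isSeed

mutate : Seed b c → Seed b c
mutate {b} {c} ((x , y) , mkSeed x>0 y>0 x∣ y∣) =
  (x′ , y) , mkSeed (factorʳ>0 {c} x xx′) y>0 (quotient-∣ x∣) (exchange-∣ {c} {b} xx′ y∣)
  where
  x′ = quotient x∣
  xx′ : x * x′ ≡ (1 + y) ^ c
  xx′ = sym (m∣n⇒n≡m*quotient x∣)

mutate-* : (s : Seed b c) → let (x , y) = proj₁ s in x * proj₁ (proj₁ (mutate s)) ≡ (1 + y) ^ c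
mutate-* ((x , y) , mkSeed x>0 y>0 x∣ y∣) = sym (m∣n⇒n≡m*quotient x∣)

-- Raising `m` by one takes two mutations, first of `x`, then of `y` with the new `x`, as the index
-- `m + 1` on the right of `rel₂` demands; `prev` undoes them in the opposite order.
next prev : Seed b c → Seed b c
next s = swapSeed (mutate (swapSeed (mutate s)))
prev s = mutate (swapSeed (mutate (swapSeed s)))

-- Friezes from orbits of seeds.

record Step (b c : ℕ) (s s′ : ℕ × ℕ) : Set where
  constructor mkStep
  field
    x-rel : proj₁ s * proj₁ s′ ≡ (1 + proj₂ s) ^ c
    y-rel : proj₂ s * proj₂ s′ ≡ (1 + proj₁ s′) ^ b

step-next : (s : Seed b c) → Step b c (proj₁ s) (proj₁ (next s))
step-next s = mkStep (mutate-* s) (mutate-* (swapSeed (mutate s)))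

step-prev : (s : Seed b c) → Step b c (proj₁ (prev s)) (proj₁ s)
step-prev s = mkStep
  (trans (*-comm (proj₁ (proj₁ (prev s))) _) (mutate-* (swapSeed (mutate (swapSeed s)))))
  (trans (*-comm (proj₂ (proj₁ (prev s))) _) (mutate-* (swapSeed s)))

orbit : Seed b c → ℤ → Seed b c
orbit s (⁺ n)    = fold s next n
orbit s -[1+ n ] = fold s prev (suc n)

step-orbit : ∀ (s : Seed b c) m → Step b c (proj₁ (orbit s m)) (proj₁ (orbit s (m +ℤ ⁺ 1)))
step-orbit {b} {c} s (⁺ n) =
  subst (λ m → Step b c (proj₁ (fold s next n)) (proj₁ (fold s next m))) (+-comm 1 n)
    (step-next (fold s next n))
step-orbit s -[1+ zero ]  = step-prev s
step-orbit s -[1+ suc n ] = step-prev (fold s prev (suc n))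

frieze : Seed b c → YFrieze b c
frieze {b} {c} s = k , record
  { positive = positive
  ; rel₁ = Step.x-rel ∘ step-orbit s
  ; rel₂ = Step.y-rel ∘ step-orbit s
  }
  where
  k : Fin 2 → ℤ → ℕ
  k zero       m = proj₁ (proj₁ (orbit s m))
  k (suc zero) m = proj₂ (proj₁ (orbit s m))
  positive : ∀ i m → 0 < k i m
  positive zero       m = IsSeed.x>0 (proj₂ (orbit s m))
  positive (suc zero) m = IsSeed.y>0 (proj₂ (orbit s m))

-- Friezes are determined by their initial seed.

initial : YFrieze b c → ℕ × ℕ
initial (k , _) = k one (⁺ 0) , k two (⁺ 0)

initial-isSeed : (F : YFrieze b c) → IsSeed b c (initial F)
initial-isSeed (k , isY) =
  mkSeed (positive one (⁺ 0)) (positive two (⁺ 0))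
    (subst (k one (⁺ 0) ∣_) (rel₁ (⁺ 0)) (m∣m*n _))
    -- The right side of `rel₂` has index `m + 1`, so `k one` at 0 appears for m = -1.
    (subst (k two (⁺ 0) ∣_) (rel₂ -[1+ 0 ]) (n∣m*n (k two -[1+ 0 ])))
  where open IsYFrieze isY

ℤ-induction : (P : ℤ → Set) → P (⁺ 0) →
  (∀ m → P m → P (m +ℤ ⁺ 1)) → (∀ m → P (m +ℤ ⁺ 1) → P m) → ∀ m → P m
ℤ-induction P p0 up down (⁺ zero)  = p0
ℤ-induction P p0 up down (⁺ suc n) =
  subst (P ∘ ⁺_) (+-comm n 1) (up (⁺ n) (ℤ-induction P p0 up down (⁺ n)))
ℤ-induction P p0 up down -[1+ zero ]  = down -[1+ zero ] p0
ℤ-induction P p0 up down -[1+ suc n ] = down -[1+ suc n ] (ℤ-induction P p0 up down -[1+ n ])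

cancelˡ : ∀ {m n o p q} → 0 < m → m ≡ o → m * n ≡ p → o * q ≡ p → n ≡ q
cancelˡ {m} {n} {q = q} m>0 refl e e′ = *-cancelˡ-≡ n q m {{>-nonZero m>0}} (trans e (sym e′))

cancelʳ : ∀ {m n o p q} → 0 < n → n ≡ o → m * n ≡ p → q * o ≡ p → m ≡ q
cancelʳ {m} {n} {q = q} n>0 refl e e′ = *-cancelʳ-≡ m q n {{>-nonZero n>0}} (trans e (sym e′))

-- Positive values cancel, so each relation determines either left factor from the other. Going up,
-- row two needs the new value of row one; going down, the order is reversed.
initial-injective : (F G : YFrieze b c) → initial F ≡ initial G → F ≈F G
initial-injective {b} {c} (k , isK) (l , isL) eq = agree
  where
  module K = IsYFrieze isK
  module L = IsYFrieze isL
  Agree : ℤ → Set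
  Agree m = k one m ≡ l one m × k two m ≡ l two m
  up : ∀ m → Agree m → Agree (m +ℤ ⁺ 1)
  up m (e₁ , e₂) = e₁′ , e₂′
    where
    e₁′ = cancelˡ (K.positive one m) e₁ (K.rel₁ m)
      (trans (L.rel₁ m) (cong (λ z → (1 + z) ^ c) (sym e₂)))
    e₂′ = cancelˡ (K.positive two m) e₂ (K.rel₂ m)
      (trans (L.rel₂ m) (cong (λ z → (1 + z) ^ b) (sym e₁′)))
  down : ∀ m → Agree (m +ℤ ⁺ 1) → Agree m
  down m (e₁ , e₂) = e₁′ , e₂′
    where
    e₂′ = cancelʳ (K.positive two (m +ℤ ⁺ 1)) e₂ (K.rel₂ m)
      (trans (L.rel₂ m) (cong (λ z → (1 + z) ^ b) (sym e₁)))
    e₁′ = cancelʳ (K.positive one (m +ℤ ⁺ 1)) e₁ (K.rel₁ m)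
      (trans (L.rel₁ m) (cong (λ z → (1 + z) ^ c) (sym e₂′)))
  agreeAll : ∀ m → Agree m
  agreeAll = ℤ-induction Agree (cong proj₁ eq , cong proj₂ eq) up down
  agree : ∀ i m → k i m ≡ l i m
  agree zero       m = proj₁ (agreeAll m)
  agree (suc zero) m = proj₂ (agreeAll m)

-- Counting friezes by counting seeds.

-- Bare pairs are counted, so that proofs of divisibility need not be compared.
ExactlySeeds : ℕ → ℕ → ℕ → Set
ExactlySeeds n b c = Σ (Fin n → ℕ × ℕ) λ v →
  (∀ i → IsSeed b c (v i)) × (∀ i j → v i ≡ v j → i ≡ j) × (∀ s → IsSeed b c s → ∃ λ i → s ≡ v i)

exactlySeeds⇒exactlyYFriezes : ∀ {n} → ExactlySeeds n b c → ExactlyYFriezes n b c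
exactlySeeds⇒exactlyYFriezes (v , seeds , injective , complete) =
  F ,
  (λ i j eq → injective i j (cong₂ _,_ (eq one (⁺ 0)) (eq two (⁺ 0)))) ,
  λ G → let (i , eq) = complete (initial G) (initial-isSeed G) in i , initial-injective G (F i) eq
  where F = λ i → frieze (v i , seeds i)

-- The symmetry between b and c is a plain `swap` on seeds; on friezes one row would also have to be
-- shifted.
exactlySeeds-swap : ∀ {n} → ExactlySeeds n b c → ExactlySeeds n c b
exactlySeeds-swap (v , seeds , injective , complete) =
  swap ∘ v , swap-isSeed ∘ seeds ,
  (λ i j eq → injective i j (cong swap eq)) ,
  λ s isSeed → let (i , eq) = complete (swap s) (swap-isSeed isSeed) in i , cong swap eq

exactly⇒finitely : ∀ {n} → ExactlyYFriezes n b c → FinitelyManyYFriezes b c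
exactly⇒finitely (v , _ , complete) =
  tabulate v , λ F → let (i , F≈) = complete F in tabulate⁺ i F≈

-- Infinitely many friezes for bc ≥ 4.

-- Multiplying two consecutive relations `x-rel` gives x x′² x″ = ((1 + y)(1 + y′))ᶜ ≥ (y y′)ᶜ = (1
-- + x′)^(bc) > x′⁴, hence x x″ > x′²; now use x < x′.
growth : ∀ {s t u} → 4 ≤ b * c →
  Step b c s t → Step b c t u → proj₁ s < proj₁ t → proj₁ t < proj₁ u
growth {b} {c} {x , y} {x′ , y′} {x″ , y″} 4≤bc (mkStep xx′ yy′) (mkStep x′x″ _) x<x′ =
  *-cancelˡ-< x′ x′ x″ (<-≤-trans square<xx″ (*-monoˡ-≤ x″ (<⇒≤ x<x′)))
  where
  fourth : x′ * x′ * (x′ * x′) < x′ * x′ * (x * x″)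
  fourth = begin-strict
    x′ * x′ * (x′ * x′)             ≡⟨ lemma₁ x′ ⟩
    x′ ^ 4                          <⟨ ^-monoˡ-< 4 (n<1+n x′) ⟩
    (1 + x′) ^ 4                    ≤⟨ ^-monoʳ-≤ (1 + x′) 4≤bc ⟩
    (1 + x′) ^ (b * c)              ≡⟨ sym (^-*-assoc (1 + x′) b c) ⟩
    ((1 + x′) ^ b) ^ c              ≡⟨ cong (_^ c) (sym yy′) ⟩
    (y * y′) ^ c                    ≤⟨ ^-monoˡ-≤ c (*-mono-≤ (n≤1+n y) (n≤1+n y′)) ⟩
    ((1 + y) * (1 + y′)) ^ c        ≡⟨ ^-distribʳ-* c (1 + y) (1 + y′) ⟩
    (1 + y) ^ c * (1 + y′) ^ c      ≡⟨ cong₂ _*_ (sym xx′) (sym x′x″) ⟩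
    x * x′ * (x′ * x″)              ≡⟨ lemma₂ x x′ x″ ⟩
    x′ * x′ * (x * x″)              ∎
    where
    open ≤-Reasoning
    lemma₁ : ∀ x → x * x * (x * x) ≡ x * (x * (x * (x * 1)))
    lemma₁ = solve-∀
    lemma₂ : ∀ x y z → x * y * (y * z) ≡ y * y * (x * z)
    lemma₂ = solve-∀
  square<xx″ : x′ * x′ < x * x″
  square<xx″ = *-cancelˡ-< (x′ * x′) (x′ * x′) (x * x″) fourth

seed₁₁ : Seed b c
seed₁₁ = (1 , 1) , mkSeed (s≤s z≤n) (s≤s z≤n) (1∣ _) (1∣ _)

orbit-increasing : ∀ b c → 1 ≤ c → 4 ≤ b * c → ∀ n →
  proj₁ (proj₁ (fold (seed₁₁ {b} {c}) next n)) < proj₁ (proj₁ (fold (seed₁₁ {b} {c}) next (suc n)))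
orbit-increasing b c 1≤c 4≤bc zero = begin-strict
  1         <⟨ ^-monoʳ-≤ 2 1≤c ⟩
  2 ^ c     ≡⟨ sym (Step.x-rel (step-next (seed₁₁ {b} {c}))) ⟩
  1 * x₁    ≡⟨ *-identityˡ x₁ ⟩
  x₁        ∎
  where
  open ≤-Reasoning
  x₁ = proj₁ (proj₁ (next (seed₁₁ {b} {c})))
orbit-increasing b c 1≤c 4≤bc (suc n) =
  growth 4≤bc (step-next s) (step-next s′) (orbit-increasing b c 1≤c 4≤bc n)
  where
  s s′ : Seed b c
  s  = fold seed₁₁ next n
  s′ = fold seed₁₁ next (suc n)

increasing⇒≥ : (f : ℕ → ℕ) → (∀ n → f n < f (suc n)) → ∀ n → n ≤ f n
increasing⇒≥ f f< zero    = z≤n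
increasing⇒≥ f f< (suc n) = ≤-<-trans (increasing⇒≥ f f< n) (f< n)

∈⇒initial≤sum : ∀ {F : YFrieze b c} {L} → Any (F ≈F_) L →
  proj₁ (initial F) ≤ sum (map (proj₁ ∘ initial) L)
∈⇒initial≤sum (here F≈)  = ≤-trans (≤-reflexive (F≈ one (⁺ 0))) (m≤m+n _ _)
∈⇒initial≤sum {F = F} (there F∈) = ≤-trans (∈⇒initial≤sum {F = F} F∈) (m≤n+m _ _)

-- The seed after `suc M` steps has first entry at least `suc M`, while a complete list would bound
-- it by `M`.
4≤bc⇒infinite : ∀ b c → 1 ≤ c → 4 ≤ b * c → ¬ FinitelyManyYFriezes b c
4≤bc⇒infinite b c 1≤c 4≤bc (L , complete) = <-irrefl refl (≤-trans
  (increasing⇒≥ (λ n → proj₁ (proj₁ (s n))) (orbit-increasing b c 1≤c 4≤bc) (suc M))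
  (∈⇒initial≤sum {F = frieze (s (suc M))} (complete (frieze (s (suc M))))))
  where
  M = sum (map (proj₁ ∘ initial) L)
  s : ℕ → Seed b c
  s = fold seed₁₁ next

-- Bounds on seeds in finite type.

-- Naming quotients as successors makes k - 1 and l - 1 variables, which avoids truncated
-- subtraction.
∣suc⇒quotient≡suc : ∀ {m n} → m ∣ suc n → ∃ λ p → suc n ≡ suc p * m
∣suc⇒quotient≡suc (divides (suc p) eq) = p , eq

-- Here y = 1 + s, k = 1 + p and k′ = 1 + q; likewise l = 1 + r below.
quotient-relation : ∀ {x s} t → IsSeed 1 c (x , suc s) → (2 + s) ^ c ≡ 1 + suc s * t →
  ∃ λ p → ∃ λ q → 1 + x ≡ suc p * suc s × suc p * suc q * suc s ≡ t + (suc p + suc q)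
quotient-relation {c} {x} {s} t isSeed power
  -- The second quotient, k′, exists because the mutated pair is again a seed with the same y.
  with ∣suc⇒quotient≡suc (y∣1+x isSeed) | ∣suc⇒quotient≡suc (y∣1+x (proj₂ (mutate (_ , isSeed))))
  where
  y∣1+x : ∀ {x y} → IsSeed 1 c (x , y) → y ∣ 1 + x
  y∣1+x {x} {y} isSeed = subst (y ∣_) (*-identityʳ (1 + x)) (IsSeed.y∣ isSeed)
... | p , 1+x | q , 1+x′ = p , q , 1+x , *-cancelˡ-≡ _ _ y (suc-injective (begin
  1 + y * (suc p * suc q * y)                       ≡⟨ lemma₁ y (suc p) (suc q) ⟩
  1 + suc p * y * (suc q * y)                       ≡⟨ sym (cong suc (cong₂ _*_ 1+x 1+x′)) ⟩
  1 + (1 + x) * (1 + x′)                            ≡⟨ lemma₂ x x′ ⟩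
  x * x′ + ((1 + x) + (1 + x′))                     ≡⟨ cong₂ _+_ (trans (mutate-* (_ , isSeed)) power) (cong₂ _+_ 1+x 1+x′) ⟩
  1 + y * t + (suc p * y + suc q * y)               ≡⟨ lemma₃ y t (suc p) (suc q) ⟩
  1 + y * (t + (suc p + suc q))                     ∎))
  where
  open ≡-Reasoning
  y = suc s
  x′ = proj₁ (proj₁ (mutate (_ , isSeed)))
  lemma₁ : ∀ y k k′ → 1 + y * (k * k′ * y) ≡ 1 + k * y * (k′ * y)
  lemma₁ = solve-∀
  lemma₂ : ∀ x x′ → 1 + (1 + x) * (1 + x′) ≡ x * x′ + ((1 + x) + (1 + x′))
  lemma₂ = solve-∀
  lemma₃ : ∀ y t k k′ → 1 + y * t + (k * y + k′ * y) ≡ 1 + y * (t + (k + k′))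
  lemma₃ = solve-∀

-- Reducing modulo `suc y` shows that it divides `u + suc n`. With `m` = k k′, `suc n` = k + k′ and
-- `u` = c, the quotient `suc r` is l.
quotient-split : ∀ {m n y u w} → m * suc y ≡ u + suc y * w + suc n →
  ∃ λ r → u + suc n ≡ suc r * suc y × m ≡ suc r + w
quotient-split {m} {n} {y} {u} {w} eq with
  ∣suc⇒quotient≡suc (subst (suc y ∣_) (+-suc u n)
    (∣m+n∣m⇒∣n (divides m (sym (trans eq (lemma u (suc y * w) (suc n))))) (m∣m*n w)))
  where
  lemma : ∀ u v n → u + v + n ≡ v + (u + n)
  lemma = solve-∀
... | r , eq′ = r , trans (+-suc u n) eq′ , *-cancelʳ-≡ m _ (suc y) (begin
  m * suc y                       ≡⟨ eq ⟩
  u + suc y * w + suc n           ≡⟨ lemma₁ u (suc y) w (suc n) ⟩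
  u + suc n + suc y * w           ≡⟨ cong (_+ suc y * w) (trans (+-suc u n) eq′) ⟩
  suc r * suc y + suc y * w       ≡⟨ lemma₂ (suc r) (suc y) w ⟩
  (suc r + w) * suc y             ∎)
  where
  open ≡-Reasoning
  lemma₁ : ∀ u y w n → u + y * w + n ≡ u + n + y * w
  lemma₁ = solve-∀
  lemma₂ : ∀ r y w → r * y + y * w ≡ (r + w) * y
  lemma₂ = solve-∀

-- Bounding k and y keeps the search box small, whereas x = k y - 1 reaches 125 for c = 3.
Bounded : ℕ → ℕ → Set
Bounded c K = ∀ {x y} → IsSeed 1 c (x , y) → ∃ λ k → 1 + x ≡ k * y × k < K × y < K

m*[1+n]+o≡p⇒m≤p : ∀ {m} n {o p} → m * suc n + o ≡ p → m ≤ p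
m*[1+n]+o≡p⇒m≤p {m} n {o} eq =
  ≤-trans (m≤m*n m (suc n)) (≤-trans (m≤m+n _ o) (≤-reflexive eq))

o+[1+n]*m≡p⇒m≤p : ∀ {m} n o {p} → o + suc n * m ≡ p → m ≤ p
o+[1+n]*m≡p⇒m≤p {m} n o eq =
  ≤-trans (m≤n*m m (suc n)) (≤-trans (m≤n+m _ o) (≤-reflexive eq))

bounds-A₂ : ∀ p q s → suc p * suc q * suc s ≡ 1 + (suc p + suc q) → p ≤ 2 × s ≤ 2
-- The argument `q + p * suc q` is k k′ - 1.
bounds-A₂ p q s eq = p≤2 q s sum≡2 , o+[1+n]*m≡p⇒m≤p (q + p * suc q) (p * q) sum≡2
  where
  lemma₁ : ∀ p q s → p * q + suc p * suc q * s + (3 + p + q) ≡ suc p * suc q * suc s + 2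
  lemma₁ = solve-∀
  lemma₂ : ∀ p q → 1 + (suc p + suc q) + 2 ≡ 2 + (3 + p + q)
  lemma₂ = solve-∀
  sum≡2 : p * q + suc p * suc q * s ≡ 2
  sum≡2 = +-cancelʳ-≡ (3 + p + q) _ _ (trans (lemma₁ p q s) (trans (cong (_+ 2) eq) (lemma₂ p q)))
  p≤2 : ∀ q s → p * q + suc p * suc q * s ≡ 2 → p ≤ 2
  -- If k′ > 1, the product `p * q` bounds `p`. If k′ = 1, it vanishes and k (y - 1) = 2 excludes y
  -- = 1 and bounds k.
  p≤2 (suc q) s e = m*[1+n]+o≡p⇒m≤p q e
  p≤2 zero zero e rewrite *-zeroʳ p | *-zeroʳ (p * 1) = contradiction e λ ()
  p≤2 zero (suc s) e rewrite *-zeroʳ p | *-identityʳ p =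
    <⇒≤ (≤-trans (m≤m*n (suc p) (suc s)) (≤-reflexive e))

bounds-C₂ : ∀ p q r s → 2 + (suc p + suc q) ≡ suc r * suc s → suc p * suc q ≡ suc r + 1 →
  p ≤ 4 × s ≤ 4
bounds-C₂ p q r s eq₁ eq₂ = p≤4 q s sum≡4 eq₂ , o+[1+n]*m≡p⇒m≤p r (p * q) sum≡4
  where
  lemma₁ : ∀ p q r s → p * q + suc r * s + (2 + p + q + r) ≡ suc p * suc q + suc r * suc s
  lemma₁ = solve-∀
  lemma₂ : ∀ p q r → (suc r + 1) + (2 + (suc p + suc q)) ≡ 4 + (2 + p + q + r)
  lemma₂ = solve-∀
  sum≡4 : p * q + suc r * s ≡ 4
  sum≡4 = +-cancelʳ-≡ (2 + p + q + r) _ _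
    (trans (lemma₁ p q r s) (trans (cong₂ _+_ eq₂ (sym eq₁)) (lemma₂ p q r)))
  p≤4 : ∀ q s → p * q + suc r * s ≡ 4 → suc p * suc q ≡ suc r + 1 → p ≤ 4
  p≤4 (suc q) s e e′ = m*[1+n]+o≡p⇒m≤p q e
  -- For k′ = 1 the sum is l (y - 1) = 4, so y > 1, and `e′` says k = l + 1; thus p = l ≤ 4.
  p≤4 zero zero e e′ rewrite *-zeroʳ p | *-zeroʳ r = contradiction e λ ()
  p≤4 zero (suc s) e e′ rewrite *-zeroʳ p =
    ≤-trans (≤-reflexive p≡1+r) (≤-trans (m≤m*n (suc r) (suc s)) (≤-reflexive e))
    where
    p≡1+r : p ≡ suc r
    p≡1+r = suc-injective (trans (sym (*-identityʳ (suc p))) (trans e′ (+-comm (suc r) 1)))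

-- The constant 20 comes from the degenerate cases: k′ = 1 gives r s = 8 and p = r + 4 + s ≤ 8 + 4 +
-- 8; l = 1 gives p q = 8 and s = 3 + p + (1 + q) ≤ 3 + 8 + 9. Otherwise a positive cofactor gives
-- the bound 8.
bounds-G₂ : ∀ p q r s → 3 + (suc p + suc q) ≡ suc r * suc s → suc p * suc q ≡ suc r + (4 + s) →
  p ≤ 20 × s ≤ 20
bounds-G₂ p q r s eq₁ eq₂ = p≤20 q r s sum≡8 eq₂ , s≤20 r p q sum≡8 eq₁
  where
  lemma₁ : ∀ p q r s → p * q + r * s + (2 + p + q + r + s) ≡ suc p * suc q + suc r * suc s
  lemma₁ = solve-∀
  lemma₂ : ∀ p q r s → (suc r + (4 + s)) + (3 + (suc p + suc q)) ≡ 8 + (2 + p + q + r + s)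
  lemma₂ = solve-∀
  sum≡8 : p * q + r * s ≡ 8
  sum≡8 = +-cancelʳ-≡ (2 + p + q + r + s) _ _
    (trans (lemma₁ p q r s) (trans (cong₂ _+_ eq₂ (sym eq₁)) (lemma₂ p q r s)))
  factors≤8 : ∀ m n → m * n ≡ 8 → m ≤ 8 × n ≤ 8
  factors≤8 m n e =
    ∣⇒≤ (divides n (sym (trans (*-comm n m) e))) , ∣⇒≤ (divides m (sym e))
  p≤20 : ∀ q r s → p * q + r * s ≡ 8 → suc p * suc q ≡ suc r + (4 + s) → p ≤ 20
  p≤20 (suc q) r s e e′ = ≤-trans (m*[1+n]+o≡p⇒m≤p q e) (m≤m+n 8 12)
  p≤20 zero r s e e′ rewrite *-zeroʳ p | *-identityʳ p with factors≤8 r s e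
  ... | r≤8 , s≤8 = ≤-trans (≤-reflexive (suc-injective e′)) (+-mono-≤ r≤8 (+-monoʳ-≤ 4 s≤8))
  s≤20 : ∀ r p q → p * q + r * s ≡ 8 → 3 + (suc p + suc q) ≡ suc r * suc s → s ≤ 20
  s≤20 (suc r) p q e e′ = ≤-trans (o+[1+n]*m≡p⇒m≤p r (p * q) e) (m≤m+n 8 12)
  s≤20 zero p q e e′ rewrite +-identityʳ (p * q) | +-identityʳ s with factors≤8 p q e
  ... | p≤8 , q≤8 = ≤-trans (≤-reflexive (sym (suc-injective e′)))
    (+-mono-≤ (m≤m+n 3 0) (+-mono-≤ p≤8 (s≤s q≤8)))

-- Here and below the box size is the bound on `p` and `s` plus two, since k = 1 + p, y = 1 + s and
-- the inequalities are strict.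
bounded-A₂ : Bounded 1 4
bounded-A₂ {y = zero} (mkSeed _ () _ _)
bounded-A₂ {y = suc s} isSeed =
  let p , q , 1+x , eq = quotient-relation 1 isSeed (lemma s)
      p≤ , s≤ = bounds-A₂ p q s eq
  in suc p , 1+x , s≤s (s≤s p≤) , s≤s (s≤s s≤)
  where
  lemma : ∀ s → (2 + s) * 1 ≡ 1 + suc s * 1
  lemma = solve-∀

bounded-C₂ : Bounded 2 6
bounded-C₂ {y = zero} (mkSeed _ () _ _)
bounded-C₂ {y = suc s} isSeed =
  let p , q , 1+x , eq = quotient-relation (2 + suc s * 1) isSeed (lemma s)
      r , eq₁ , eq₂ = quotient-split {u = 2} {w = 1} eq
      p≤ , s≤ = bounds-C₂ p q r s eq₁ eq₂
  in suc p , 1+x , s≤s (s≤s p≤) , s≤s (s≤s s≤)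
  where
  lemma : ∀ s → (2 + s) * ((2 + s) * 1) ≡ 1 + suc s * (2 + suc s * 1)
  lemma = solve-∀

bounded-G₂ : Bounded 3 22
bounded-G₂ {y = zero} (mkSeed _ () _ _)
bounded-G₂ {y = suc s} isSeed =
  -- The first argument is ((1 + y)³ - 1) / y = 3 + y (3 + y), where 3 + y is `4 + s`.
  let p , q , 1+x , eq = quotient-relation (3 + suc s * (4 + s)) isSeed (lemma s)
      r , eq₁ , eq₂ = quotient-split {u = 3} {w = 4 + s} eq
      p≤ , s≤ = bounds-G₂ p q r s eq₁ eq₂
  in suc p , 1+x , s≤s (s≤s p≤) , s≤s (s≤s s≤)
  where
  lemma : ∀ s → (2 + s) * ((2 + s) * ((2 + s) * 1)) ≡ 1 + suc s * (3 + suc s * (4 + s))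
  lemma = solve-∀

-- Enumeration of seeds by computation.

isSeed? : ∀ b c s → Dec (IsSeed b c s)
isSeed? b c (x , y) = map′
  (λ (x>0 , y>0 , x∣ , y∣) → mkSeed x>0 y>0 x∣ y∣)
  (λ (mkSeed x>0 y>0 x∣ y∣) → x>0 , y>0 , x∣ , y∣)
  (0 <? x ×-dec 0 <? y ×-dec x ∣? (1 + y) ^ c ×-dec y ∣? (1 + x) ^ b)

_≟₂_ : (s t : ℕ × ℕ) → Dec (s ≡ t)
_≟₂_ = ×-≡-dec _≟_ _≟_

-- In the last component x is written as k y - 1; for k y = 0 the truncated
-- difference 0 is excluded by positivity of seeds.
IsTable : ∀ {n} → ℕ → ℕ → Vec (ℕ × ℕ) n → Set
IsTable c K V =
  (∀ i → IsSeed 1 c (lookup V i)) ×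
  (∀ i j → lookup V i ≡ lookup V j → i ≡ j) ×
  (∀ {k} → k < K → ∀ {y} → y < K →
    IsSeed 1 c (k * y ∸ 1 , y) → ∃ λ i → (k * y ∸ 1 , y) ≡ lookup V i)

isTable? : ∀ {n} c K (V : Vec (ℕ × ℕ) n) → Dec (IsTable c K V)
isTable? c K V =
  Fin.all? (λ i → isSeed? 1 c (lookup V i))
  ×-dec Fin.all? (λ i → Fin.all? λ j → (lookup V i ≟₂ lookup V j) →-dec (i Fin.≟ j))
  ×-dec allUpTo? (λ k → allUpTo? (λ y →
    isSeed? 1 c (k * y ∸ 1 , y) →-dec Fin.any? λ i → (k * y ∸ 1 , y) ≟₂ lookup V i) K) K

-- Every seed lies in the box by `bounded`. The search runs when `True` is evaluated, so the tables
-- below can pass `_` for it.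
table⇒exactlySeeds : ∀ {n} c K (V : Vec (ℕ × ℕ) n) →
  Bounded c K → True (isTable? c K V) → ExactlySeeds n 1 c
table⇒exactlySeeds c K V bounded table =
  let seeds , injective , complete = toWitness {a? = isTable? c K V} table in
  lookup V , seeds , injective , λ (x , y) isSeed →
  let k , 1+x , k<K , y<K = bounded isSeed
      x≡ = cong (_∸ 1) 1+x
  in subst (λ z → ∃ λ i → (z , y) ≡ lookup V i) (sym x≡)
       (complete k<K y<K (subst (λ z → IsSeed 1 c (z , y)) x≡ isSeed))

seeds-A₂ : ExactlySeeds 5 1 1
seeds-A₂ = table⇒exactlySeeds 1 4
  ((1 , 1) ∷ (2 , 1) ∷ (1 , 2) ∷ (3 , 2) ∷ (2 , 3) ∷ []) bounded-A₂ _

seeds-C₂ : ExactlySeeds 10 1 2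
seeds-C₂ = table⇒exactlySeeds 2 6
  ((1 , 1) ∷ (2 , 1) ∷ (4 , 1) ∷ (1 , 2) ∷ (3 , 2) ∷ (9 , 2) ∷ (2 , 3) ∷ (8 , 3) ∷
   (4 , 5) ∷ (9 , 5) ∷ []) bounded-C₂ _

seeds-G₂ : ExactlySeeds 21 1 3
seeds-G₂ = table⇒exactlySeeds 3 22
  ((1 , 1) ∷ (2 , 1) ∷ (4 , 1) ∷ (8 , 1) ∷ (1 , 2) ∷ (3 , 2) ∷ (9 , 2) ∷ (27 , 2) ∷
   (2 , 3) ∷ (8 , 3) ∷ (32 , 3) ∷ (4 , 5) ∷ (9 , 5) ∷ (24 , 5) ∷ (54 , 5) ∷
   (8 , 9) ∷ (125 , 9) ∷ (32 , 11) ∷ (54 , 11) ∷ (27 , 14) ∷ (125 , 14) ∷ []) bounded-G₂ _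

-- From b = 1 to all b and c.

factors-of-prime : ∀ {p} b c → Prime p → b * c ≡ p → (b ≡ 1 × c ≡ p) ⊎ (b ≡ p × c ≡ 1)
factors-of-prime {p} b c pr eq with prime⇒irreducible pr (divides c (trans (sym eq) (*-comm b c)))
... | inj₁ refl = inj₁ (refl , trans (sym (*-identityˡ c)) eq)
... | inj₂ refl = inj₂ (refl , *-cancelˡ-≡ c 1 b {{prime⇒nonZero pr}} (trans eq (sym (*-identityʳ b))))

-- A prime product forces b = 1, covered by the table, or c = 1, covered by its swap.
exactly-prime : ∀ {n p} b c → Prime p → ExactlySeeds n 1 p → b * c ≡ p → ExactlyYFriezes n b c
exactly-prime b c pr seeds eq with factors-of-prime b c pr eq
... | inj₁ (refl , refl) = exactlySeeds⇒exactlyYFriezes seeds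
... | inj₂ (refl , refl) = exactlySeeds⇒exactlyYFriezes (exactlySeeds-swap seeds)

exactly-A₂ : ∀ b c → b * c ≡ 1 → ExactlyYFriezes 5 b c
exactly-A₂ b c eq with m*n≡1⇒m≡1 b c eq | m*n≡1⇒n≡1 b c eq
... | refl | refl = exactlySeeds⇒exactlyYFriezes seeds-A₂

exactly-C₂ : ∀ b c → b * c ≡ 2 → ExactlyYFriezes 10 b c
exactly-C₂ b c = exactly-prime b c prime[2] seeds-C₂

exactly-G₂ : ∀ b c → b * c ≡ 3 → ExactlyYFriezes 21 b c
exactly-G₂ b c = exactly-prime b c (from-yes (prime? 3)) seeds-G₂

-- The product is passed as a variable `n` so that its value can be matched on.
bc≤3⇒finite : ∀ b c n → 1 ≤ n → n ≤ 3 → b * c ≡ n → FinitelyManyYFriezes b c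
bc≤3⇒finite b c 1 _ _ eq = exactly⇒finitely (exactly-A₂ b c eq)
bc≤3⇒finite b c 2 _ _ eq = exactly⇒finitely (exactly-C₂ b c eq)
bc≤3⇒finite b c 3 _ _ eq = exactly⇒finitely (exactly-G₂ b c eq)
bc≤3⇒finite b c (suc (suc (suc (suc _)))) _ (s≤s (s≤s (s≤s ()))) _

theorem4p8 : ∀ (b c : ℕ) → 1 ≤ b → 1 ≤ c →
    (FinitelyManyYFriezes b c ⇔ b * c ≤ 3)
    × (b * c ≡ 1 → ExactlyYFriezes 5 b c)
    × (b * c ≡ 2 → ExactlyYFriezes 10 b c)
    × (b * c ≡ 3 → ExactlyYFriezes 21 b c)
theorem4p8 b c 1≤b 1≤c =
  mk⇔ (λ finite → ≮⇒≥ λ 4≤bc → 4≤bc⇒infinite b c 1≤c 4≤bc finite)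
      (λ bc≤3 → bc≤3⇒finite b c (b * c) (*-mono-≤ 1≤b 1≤c) bc≤3 refl) ,
  exactly-A₂ b c , exactly-C₂ b c , exactly-G₂ b c
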